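{- Let $\mathcal{G}=(V,E,\lambda)$ be a happy compressed temporal graph with $n=|V|$ vertices and lifetime $L(\mathcal{G})$. If $\mathcal{G}$ is acyclic and temporally connected, then $L(\mathcal{G})\le n/2$.
   Context: A happy temporal graph is a triple $\mathcal{G}=(V,E,\lambda)$ where $(V,E)$ is a finite simple undirected graph (the footprint) and $\lambda:E\to\{1,2,3,\dots\}$ assigns a single time label to each edge, such that two distinct edges sharing an endpoint have different labels. It is compressed if for every edge $e$ with $\lambda(e)>1$ there is an edge $e'$ adjacent to $e$ with $\lambda(e')=\lambda(e)-1$. The lifetime $L(\mathcal{G})$ is the largest time label (with $L(\mathcal{G})=0$ if there are no edges). A temporal walk is a walk in the footprint along which edge labels are strictly increasing (so no edge is repeated). $\mathcal{G}$ is temporally connected if for all distinct $u,v\in V$ there is a temporal walk from $u$ to $v$. A temporal cycle is a nonempty temporal walk from a vertex to itself; $\mathcal{G}$ is acyclic if it has no temporal cycle. -}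

module Defs where

open import Level using (0ℓ)
open import Data.Nat.Base using (ℕ; suc; _≤_; _<_)
open import Data.Fin.Base using (Fin)
open import Data.Product.Base using (Σ-syntax; ∃-syntax; _×_; _,_)
open import Data.Sum.Base using (_⊎_)
open import Data.List.Base using (List; []; _∷_; map; mapMaybe; cartesianProduct; allFin)
open import Data.List.Extrema.Nat using (max)
open import Data.List.Relation.Unary.Linked using (Linked)
open import Data.Maybe.Base using (Maybe)
import Data.Maybe.Base as Maybe
open import Relation.Nullary using (¬_)
open import Relation.Nullary.Decidable using (dec⇒maybe)
open import Relation.Binary.Core using (Rel)
open import Relation.Binary.Definitions using (Decidable; Symmetric)
open import Relation.Binary.Construct.Closure.ReflexiveTransitive using (Star; ε; _◅_)
open import Relation.Binary.PropositionalEquality using (_≡_; _≢_)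

-- Adjacency is decidable because the edge set of a finite graph is a
-- finite set.
record SimpleGraph (n : ℕ) : Set₁ where
  field
    Adj    : Rel (Fin n) 0ℓ
    adj?   : Decidable Adj
    sym    : Symmetric Adj
    irrefl : ∀ {v} → ¬ Adj v v

  -- Each undirected edge {u , v} is represented once per orientation (and
  -- per proof of adjacency); _≈ₑ_ identifies all of these representatives.
  record Edge : Set where
    constructor edge
    field
      {src tgt} : Fin n
      adj       : Adj src tgt

  open Edge public

  _∈ₑ_ : Fin n → Edge → Set
  x ∈ₑ e = x ≡ src e ⊎ x ≡ tgt e

  _≈ₑ_ : Edge → Edge → Set
  e ≈ₑ f = (src e ≡ src f × tgt e ≡ tgt f) ⊎ (src e ≡ tgt f × tgt e ≡ src f)

  Adjacentₑ : Edge → Edge → Set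
  Adjacentₑ e f = ¬ (e ≈ₑ f) × ∃[ x ] (x ∈ₑ e × x ∈ₑ f)

  edges : List Edge
  edges = mapMaybe (λ (u , v) → Maybe.map edge (dec⇒maybe (adj? u v)))
                   (cartesianProduct (allFin n) (allFin n))

  Walk : Rel (Fin n) 0ℓ
  Walk = Star Adj

record HappyTemporalGraph (n : ℕ) : Set₁ where
  field
    footprint : SimpleGraph n

  open SimpleGraph footprint public

  field
    label        : Edge → ℕ
    -- makes label a function on undirected edges
    label-cong   : ∀ e f → e ≈ₑ f → label e ≡ label f
    label-pos    : ∀ e → 1 ≤ label e
    label-proper : ∀ e f → Adjacentₑ e f → label e ≢ label f

  lifetime : ℕ
  lifetime = max 0 (map label edges)

  Compressed : Set
  Compressed = ∀ e → 1 < label e → ∃[ f ] (Adjacentₑ e f × suc (label f) ≡ label e)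

  labels : ∀ {u v} → Walk u v → List ℕ
  labels ε       = []
  labels (a ◅ p) = label (edge a) ∷ labels p

  IsTemporal : ∀ {u v} → Walk u v → Set
  IsTemporal p = Linked _<_ (labels p)

  TemporallyConnected : Set
  TemporallyConnected = ∀ u v → u ≢ v → Σ[ p ∈ Walk u v ] IsTemporal p

  TemporalCycle : Set
  TemporalCycle = ∃[ v ] Σ[ p ∈ Walk v v ] (p ≢ ε × IsTemporal p)

  Acyclic : Set
  Acyclic = ¬ TemporalCycle

{-# OPTIONS --safe #-}
-- Because no one can hear back its own information, the first edge uv of a
-- vertex u is also the first edge of v: if vz came before uv, the journey from
-- u to z could be prefixed by z → v (→ u) to a temporal cycle at z.  Hence the
-- first edges form a perfect matching.  Call the shadow of an edge e the set
-- of vertices with a journey that ends at e before e is traversed.  Shadows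
-- are unions of matched pairs.  If f and e = yz share y and carry labels k and
-- k + 1, then the shadow of e contains that of f, and also z, which is not in
-- the shadow of f since otherwise z → y → z would be a temporal cycle; so it
-- contains a whole new pair.  By induction the shadow of an edge with label k
-- has at least 2k vertices.
module Submission where

open import Defs
open import Data.Nat.Base using (ℕ; zero; suc; _*_; _≤_; _<_; z≤n; s≤s)
open import Data.Nat.Properties
  using (≤-refl; ≤-reflexive; ≤-trans; <-trans; n≤1+n; m≤n⇒m≤1+n; ≮⇒≥; <-irrefl;
         suc-injective; *-suc; m≤n⇒m<n∨m≡n; _<?_)
open import Data.Nat.Induction using (<-wellFounded)
open import Data.Fin.Base using (Fin; zero; suc)
open import Data.Fin.Properties using (_≟_; any?; injective⇒≤)
open import Data.List.Base using (List; []; _∷_; length; lookup; map)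
open import Data.List.Extrema.Nat using (argmax-all)
open import Data.List.Membership.Propositional.Properties using (∈-lookup)
open import Data.List.Relation.Unary.All as All using (All; []; _∷_)
open import Data.List.Relation.Unary.All.Properties using (map⁺)
open import Data.List.Relation.Unary.AllPairs using ([]; _∷_)
open import Data.List.Relation.Unary.Linked using (Linked; [-]; _∷_)
open import Data.List.Relation.Unary.Unique.Propositional using (Unique)
open import Data.Product.Base using (Σ-syntax; ∃-syntax; _×_; _,_; proj₂)
open import Data.Sum.Base using (inj₁; inj₂)
open import Function.Base using (id)
open import Induction.WellFounded using (Acc; acc)
open import Relation.Binary.Construct.Closure.ReflexiveTransitive using (ε; _◅_)
open import Relation.Binary.PropositionalEquality
  using (_≡_; _≢_; refl; sym; trans; cong; subst)
open import Relation.Nullary using (¬_; Dec; yes; no; contradiction)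

lookup-injective : ∀ {A : Set} {xs : List A} → Unique xs →
                   ∀ {i j} → lookup xs i ≡ lookup xs j → i ≡ j
lookup-injective (x∉ ∷ _) {zero}  {zero}  eq = refl
lookup-injective (x∉ ∷ _) {zero}  {suc j} eq = contradiction eq (All.lookup x∉ (∈-lookup j))
lookup-injective (x∉ ∷ _) {suc i} {zero}  eq = contradiction (sym eq) (All.lookup x∉ (∈-lookup i))
lookup-injective (_ ∷ u)  {suc i} {suc j} eq = cong suc (lookup-injective u eq)

-- `lookup` injects the positions of a duplicate-free list into `Fin n`; this turns a list of shadow
-- vertices into a lower bound on `n`.
Unique⇒length≤ : ∀ {n} {xs : List (Fin n)} → Unique xs → length xs ≤ n
Unique⇒length≤ u = injective⇒≤ (lookup-injective u)

module Journeys {n} (G : HappyTemporalGraph n) where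
  open HappyTemporalGraph G renaming (sym to adj-sym)

  λₑ : ∀ {u v} → Adj u v → ℕ
  λₑ a = label (edge a)

  λₑ-irrelevant : ∀ {u v} (a b : Adj u v) → λₑ a ≡ λₑ b
  λₑ-irrelevant a b = label-cong (edge a) (edge b) (inj₁ (refl , refl))

  λₑ-sym : ∀ {u v} (a : Adj u v) → λₑ (adj-sym a) ≡ λₑ a
  λₑ-sym a = label-cong (edge (adj-sym a)) (edge a) (inj₂ (refl , refl))

  -- Serves to recognise first edges: an edge at `u` that ties with the first one has the same other
  -- end.
  λₑ-proper : ∀ {u v w} (a : Adj u v) (b : Adj u w) → λₑ a ≡ λₑ b → v ≡ w
  λₑ-proper {u} {v} {w} a b eq with v ≟ w
  ... | yes v≡w = v≡w
  ... | no  v≢w = contradiction eq (label-proper (edge a) (edge b)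
    ((λ { (inj₁ (_ , v≡w))   → v≢w v≡w
        ; (inj₂ (u≡w , v≡u)) → v≢w (trans v≡u u≡w) })
    , u , inj₁ refl , inj₁ refl))

  orient : ∀ {x} e → x ∈ₑ e → ∃[ y ] Σ[ a ∈ Adj x y ] (λₑ a ≡ label e × y ∈ₑ e)
  orient (edge a) (inj₁ refl) = _ , a , refl , inj₂ refl
  orient (edge a) (inj₂ refl) = _ , adj-sym a , λₑ-sym a , inj₁ refl

  -- The window of allowed labels is part of the type: `lo` rises along the journey while the
  -- exclusive bound `hi` stays fixed, so attaching an edge at either end only needs comparisons
  -- with a bound.
  data Journey (lo hi : ℕ) : Fin n → Fin n → Set where
    stay : ∀ {u} → Journey lo hi u u
    move : ∀ {u v w} (a : Adj u v) → lo ≤ λₑ a → λₑ a < hi →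
           Journey (suc (λₑ a)) hi v w → Journey lo hi u w

  move-back : ∀ {lo hi u v w} (a : Adj u v) → lo ≤ λₑ a → λₑ a < hi →
              Journey (suc (λₑ a)) hi u w → Journey lo hi v w
  move-back a l h p rewrite sym (λₑ-sym a) = move (adj-sym a) l h p

  later-start : ∀ {lo lo′ hi u v} → lo ≤ lo′ → Journey lo′ hi u v → Journey lo hi u v
  later-start lo≤ stay           = stay
  later-start lo≤ (move a l h p) = move a (≤-trans lo≤ l) h p

  earlier-end : ∀ {lo hi hi′ u v} → hi ≤ hi′ → Journey lo hi u v → Journey lo hi′ u v
  earlier-end hi≤ stay           = stay
  earlier-end hi≤ (move a l h p) = move a l (≤-trans h hi≤) (earlier-end hi≤ p)

  snoc : ∀ {lo hi u v w} → Journey lo hi u v → (a : Adj v w) → lo ≤ λₑ a →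
         hi ≤ λₑ a → Journey lo (suc (λₑ a)) u w
  snoc stay           a lo≤ hi≤ = move a lo≤ ≤-refl stay
  snoc (move b l h p) a lo≤ hi≤ =
    move b l (m≤n⇒m≤1+n (≤-trans h hi≤)) (snoc p a (≤-trans h hi≤) hi≤)

  walk : ∀ {lo hi u v} → Journey lo hi u v → Walk u v
  walk stay           = ε
  walk (move a _ _ p) = a ◅ walk p

  walk-temporal : ∀ {l lo hi u v} (p : Journey lo hi u v) → l < lo →
                  Linked _<_ (l ∷ labels (walk p))
  walk-temporal stay             l<lo = [-]
  walk-temporal (move a lo≤ _ p) l<lo = ≤-trans l<lo lo≤ ∷ walk-temporal p ≤-refl

  journey-after : ∀ {l u v} (p : Walk u v) → Linked _<_ (l ∷ labels p) →
                  ∃[ hi ] (l < hi × Journey (suc l) hi u v)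
  journey-after {l} ε       _            = suc l , ≤-refl , stay
  journey-after     (a ◅ p) (l<a ∷ rest) with journey-after p rest
  ... | hi , a<hi , q = hi , <-trans l<a a<hi , move a l<a a<hi q

  temporal⇒journey : ∀ {u v} (p : Walk u v) → IsTemporal p → ∃[ hi ] Journey 0 hi u v
  temporal⇒journey ε       _ = 0 , stay
  temporal⇒journey (a ◅ p) t with journey-after p t
  ... | hi , a<hi , q = hi , move a z≤n a<hi q

  Shadow : Edge → Fin n → Set
  Shadow e x = ∃[ y ] (y ∈ₑ e × Journey 0 (label e) x y)

  -- A journey that stops at the other endpoint is completed by crossing `e` itself, hence the bound
  -- one above `label e`.
  shadow⇒endpoint : ∀ {e x y} → Shadow e x → y ∈ₑ e → Journey 0 (suc (label e)) x y
  shadow⇒endpoint {e} (.(src e) , inj₁ refl , p) (inj₁ refl) = earlier-end (n≤1+n _) p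
  shadow⇒endpoint {e} (.(tgt e) , inj₂ refl , p) (inj₂ refl) = earlier-end (n≤1+n _) p
  shadow⇒endpoint {edge a} (_ , inj₁ refl , p) (inj₂ refl) = snoc p a z≤n ≤-refl
  shadow⇒endpoint {edge a} (_ , inj₂ refl , p) (inj₁ refl) =
    earlier-end (s≤s (≤-reflexive (λₑ-sym a)))
      (snoc p (adj-sym a) z≤n (≤-reflexive (sym (λₑ-sym a))))

  IsFirst : ∀ {u v} → Adj u v → Set
  IsFirst {u} a = ∀ {w} (b : Adj u w) → λₑ a ≤ λₑ b

  first-edge : ∀ {u v} → Adj u v → ∃[ w ] Σ[ a ∈ Adj u w ] IsFirst a
  first-edge {u} a = go a (<-wellFounded _)
    where
    earlier? : ∀ k w → Dec (Σ[ b ∈ Adj u w ] λₑ b < k)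
    earlier? k w with adj? u w
    ... | no ¬b = no λ (b , _) → ¬b b
    ... | yes b with λₑ b <? k
    ...   | yes b<k = yes (b , b<k)
    ...   | no  b≮k = no λ (c , c<k) → b≮k (subst (_< k) (λₑ-irrelevant c b) c<k)

    go : ∀ {v} (a : Adj u v) → Acc _<_ (λₑ a) → ∃[ w ] Σ[ b ∈ Adj u w ] IsFirst b
    go a (acc rec) with any? (earlier? (λₑ a))
    ... | yes (_ , b , b<a) = go b (rec b<a)
    ... | no  none          = _ , a , λ b → ≮⇒≥ λ b<a → none (_ , b , b<a)

  module _ (acyclic : Acyclic) where

    no-return-after : ∀ {hi u v} (a : Adj u v) → ¬ Journey (suc (λₑ a)) hi v u
    no-return-after a p = acyclic (_ , a ◅ walk p , (λ ()) , walk-temporal p ≤-refl)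

    -- Appending `a` closes the journey to a cycle at `v`, which `no-return-after` refutes with the
    -- journey's first edge as the opening one.
    no-return-before : ∀ {u v} (a : Adj u v) → ¬ Journey 0 (λₑ a) v u
    no-return-before a stay           = irrefl a
    no-return-before a (move b _ h p) = no-return-after b (snoc p a h ≤-refl)

    module _ (connected : TemporallyConnected) where

      first-symmetric : ∀ {u v} (a : Adj u v) → IsFirst a → IsFirst (adj-sym a)
      first-symmetric {u} {v} a first {z} c =
        ≮⇒≥ λ c<a′ → impossible (subst (λₑ c <_) (λₑ-sym a) c<a′)
        where
        impossible : ¬ λₑ c < λₑ a
        impossible c<a = clash (proj₂ (temporal⇒journey _ (proj₂ (connected u z u≢z))))
          where
          u≢z : u ≢ z
          u≢z refl = <-irrefl (trans (λₑ-irrelevant c (adj-sym a)) (λₑ-sym a)) c<a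

          c⁻¹<a : λₑ (adj-sym c) < λₑ a
          c⁻¹<a = subst (_< λₑ a) (sym (λₑ-sym c)) c<a

          clash : ∀ {hi} → ¬ Journey 0 hi u z
          clash stay = u≢z refl
          clash (move b _ h p) with m≤n⇒m<n∨m≡n (first b)
          ... | inj₁ a<b = no-return-after (adj-sym c)
            (move-back a c⁻¹<a (<-trans a<b h) (move b a<b h p))
          -- The journey opens with `a` itself, so its tail already leads from `v` to `z` and only
          -- `c` reversed is prefixed.
          ... | inj₂ a≡b with refl ← λₑ-proper a b a≡b =
            no-return-after (adj-sym c)
              (later-start (s≤s (≤-trans (n≤1+n _) (≤-trans c⁻¹<a (≤-reflexive a≡b)))) p)

      -- A journey from `u` that opens with the first edge has a tail starting at `v`; any other
      -- opens later, so `v` can join it by crossing `a` first.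
      shadow-mate : ∀ {e u v} (a : Adj u v) → IsFirst a → Shadow e u → Shadow e v
      -- With no first move to compare, `e` itself takes that role: either it is later than `a`, or
      -- `v` is its other endpoint.
      shadow-mate {e} a first (_ , u∈e , stay) with orient e u∈e
      ... | w , b , b≡e , w∈e with m≤n⇒m<n∨m≡n (first b)
      ...   | inj₁ a<b = _ , u∈e , move-back a z≤n (subst (λₑ a <_) b≡e a<b) stay
      ...   | inj₂ a≡b with refl ← λₑ-proper a b a≡b = w , w∈e , stay
      shadow-mate a first (y , y∈e , move b _ h p) with m≤n⇒m<n∨m≡n (first b)
      ... | inj₁ a<b = y , y∈e ,
        move-back a z≤n (<-trans a<b h) (move b a<b h p)
      ... | inj₂ a≡b with refl ← λₑ-proper a b a≡b = y , y∈e , later-start z≤n p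

      record Shadows (e : Edge) (k : ℕ) : Set where
        constructor shadows
        field
          {vertices} : List (Fin n)
          unique     : Unique vertices
          inShadow   : All (Shadow e) vertices
          size       : length vertices ≡ 2 * k

      module _ (compressed : Compressed) where

        shadow-size : ∀ k e → label e ≡ suc k → Shadows e (suc k)
        shadow-size zero e _ = shadows
          (((λ s≡t → irrefl (subst (Adj _) (sym s≡t) (adj e))) ∷ []) ∷ [] ∷ [])
          ((_ , inj₁ refl , stay) ∷ (_ , inj₂ refl , stay) ∷ []) refl
        shadow-size (suc k) e e≡2+k
          with f , (_ , y , y∈e , y∈f) , 1+f≡e
                 ← compressed e (subst (1 <_) (sym e≡2+k) (s≤s (s≤s z≤n)))
          with shadows {xs} unique inShadow size
                 ← shadow-size k f (suc-injective (trans 1+f≡e e≡2+k))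
          with z , a , a≡e , z∈e ← orient e y∈e
          -- Here `adj-sym a` only witnesses that `z` has an edge; the new pair is `z` and its mate
          -- `v`.
          with v , b , first ← first-edge (adj-sym a) = shadows
            (((λ z≡v → irrefl (subst (Adj z) (sym z≡v) b)) ∷ new z∉f) ∷ new v∉f ∷ unique)
            ((z , z∈e , stay) ∷ shadow-mate b first (z , z∈e , stay)
              ∷ All.map enlarge inShadow)
            (trans (cong (λ m → suc (suc m)) size) (sym (*-suc 2 (suc k))))
          where
          -- Crossing `f` to reach `y` is still in time, as `label f` is just below `label e`.
          enlarge : ∀ {x} → Shadow f x → Shadow e x
          enlarge s = y , y∈e , subst (λ h → Journey 0 h _ y) 1+f≡e (shadow⇒endpoint s y∈f)

          z∉f : ¬ Shadow f z
          z∉f s = no-return-before a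
            (subst (λ h → Journey 0 h z y) (trans 1+f≡e (sym a≡e)) (shadow⇒endpoint s y∈f))

          -- By `first-symmetric`, `b` reversed is the first edge of `v`, so membership would pass
          -- from `v` back to `z`.
          v∉f : ¬ Shadow f v
          v∉f s = z∉f (shadow-mate (adj-sym b) (first-symmetric b first) s)

          new : ∀ {x} → ¬ Shadow f x → All (x ≢_) xs
          new x∉f = All.map (λ { s refl → x∉f s }) inShadow

        2*label≤n : ∀ e → 2 * label e ≤ n
        2*label≤n e = bound (label e) refl
          where
          bound : ∀ l → label e ≡ l → 2 * l ≤ n
          bound zero    _  = z≤n
          bound (suc k) eq with shadows unique _ size ← shadow-size k e eq =
            subst (_≤ n) size (Unique⇒length≤ unique)

lemma3p8 : ∀ (n : ℕ) (G : HappyTemporalGraph n) →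
    let open HappyTemporalGraph G in
    Compressed → Acyclic → TemporallyConnected → 2 * lifetime ≤ n
lemma3p8 n G compressed acyclic connected =
  -- The `z≤n` covers the default 0 of `max`.
  argmax-all id {P = λ l → 2 * l ≤ n} {xs = map label edges} z≤n
    (map⁺ (All.universal (Journeys.2*label≤n G acyclic connected compressed) edges))
  where open HappyTemporalGraph G
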